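{- Let $N$ be a positive integer which is not a perfect square, let $p$ be an integer with $p^2<N$, let $q$ be a positive integer dividing $N-p^2$, and put $\alpha=\frac{\sqrt N+p}{q}$. Let $(x_n)$, $(c_n)$, $(d_n)$, $(s_n)$ be the sequences associated with the left-positive path (LPP) of $\alpha$, and let $T$ be the least period of the LPP. Assume $x_m=-\alpha^*$ for a certain positive integer $m$. Then: 1. The list $(c_0,c_1,\dots,c_{m-1},c_m)$ is antisymmetric (that is, $c_{m-j}=-c_j$ for all $0\le j\le m$) and the list $(d_0,d_1,\dots,d_{m-1},d_m)$ is symmetric (that is, $d_{m-j}=d_j$ for all $0\le j\le m$). In particular, if $m=2k$ is even then $c_k=0$ and $x_k=\frac{\sqrt N}{d_k}$. 2. The list $(s_0,s_1,\dots,s_{m-1})$ is a palindrome: for every integer $j\in\{0,1,\dots,m-1\}$, $s_{m-1-j}=s_j$. 3. For every $n\in\{0,1,\dots,T\}$, there exists $k(n)\in\{0,1,\dots,T\}$ such that $-x_n^*=x_{k(n)}$.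
   Context: The Calkin-Wilf tree of $\alpha$ is the infinite binary tree whose root is labeled $\alpha$ and in which every vertex labeled $x$ has a left child labeled $\frac{x}{x+1}$ and a right child labeled $x+1$ (since $\alpha>0$, all labels are positive). Each vertex carries a triple $(\varepsilon,c,d)$ with $\varepsilon\in\{ -1,1\}$, $c$ an integer, $d$ a positive integer dividing $N-c^2$, and label equal to $\frac{\varepsilon\sqrt N+c}{d}$, defined as follows. The root has triple $(1,p,q)$. If a vertex has triple $(\varepsilon,c,d)$, its right child has triple $(\varepsilon,c+d,d)$; its left child has triple $\left(-\varepsilon,\frac{N-c^2}{d}-c,\frac{N-(c+d)^2}{d}\right)$ if $N-(c+d)^2>0$, and $\left(\varepsilon,c-\frac{N-c^2}{d},\frac{(c+d)^2-N}{d}\right)$ otherwise. The left-positive path (LPP) of $\alpha$ is the infinite descending path which starts at the root and which, from each vertex, goes to the left child if the value of $\varepsilon$ for that left child is $1$, and to the right child otherwise. Along the LPP one always has $\varepsilon=1$. $x_n$ denotes the label of the $n$-th vertex of the LPP, with $x_0=\alpha$, and $c_n,d_n$ are the values of $c,d$ at that vertex, so $x_n=\frac{\sqrt N+c_n}{d_n}$. Put $s_n=\ell$ if the step from $x_n$ to $x_{n+1}$ goes to the left child, and $s_n=r$ if it goes to the right child. The sequence $(x_n)$ is purely periodic, and $T$ denotes its least period, i.e. the least positive integer such that $x_T=\alpha$. For rational numbers $a,b$, the algebraic conjugate of $x=a\sqrt N+b$ is $x^*=-a\sqrt N+b$. -}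

module Defs where

open import Data.Nat.Base as ℕ using (ℕ; zero; suc)
open import Data.Integer.Base as ℤ using (ℤ; +_; +[1+_]; -[1+_])
import Data.Integer.Properties as ℤ
open import Data.Product.Base using (_×_; ∃-syntax)
open import Data.Rational.Base as ℚ using (ℚ; 0ℚ; 1ℚ)
import Data.Rational.Properties as ℚ
open import Data.Sign.Base as Sign using (Sign; opposite)
open import Relation.Binary.PropositionalEquality.Core using (_≡_)
open import Relation.Nullary.Decidable.Core using (yes; no)

PerfectSquare : ℕ → Set
PerfectSquare N = ∃[ k ] N ≡ k ℕ.* k

-- ⟨ a , b ⟩ : ℚ√ N  stands for the number a√N + b.  When N is not a perfect
-- square this representation is unique, so _≡_ is equality of numbers.
record ℚ√ (N : ℕ) : Set where
  constructor ⟨_,_⟩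
  field
    surd     : ℚ
    rational : ℚ

-- Division is made total by recipℚ 0ℚ = 0ℚ.  For N not a perfect square the
-- norm in recip vanishes only at zero, so recip is the inverse of every
-- nonzero element.
recipℚ : ℚ → ℚ
recipℚ r with r ℚ.≟ 0ℚ
... | yes _  = 0ℚ
... | no r≢0 = ℚ.1/_ r {{ℚ.≢-nonZero r≢0}}

module _ {N : ℕ} where

  infixl 6 _⊕_
  infixl 7 _⊗_ _⊘_
  infix  8 ⊝_ _*

  fromℤ : ℤ → ℚ√ N
  fromℤ i = ⟨ 0ℚ , i ℚ./ 1 ⟩

  √N : ℚ√ N
  √N = ⟨ 1ℚ , 0ℚ ⟩

  _⊕_ : ℚ√ N → ℚ√ N → ℚ√ N
  ⟨ a , b ⟩ ⊕ ⟨ a′ , b′ ⟩ = ⟨ a ℚ.+ a′ , b ℚ.+ b′ ⟩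

  ⊝_ : ℚ√ N → ℚ√ N
  ⊝ ⟨ a , b ⟩ = ⟨ ℚ.- a , ℚ.- b ⟩

  _⊗_ : ℚ√ N → ℚ√ N → ℚ√ N
  ⟨ a , b ⟩ ⊗ ⟨ a′ , b′ ⟩ =
    ⟨ a ℚ.* b′ ℚ.+ b ℚ.* a′ , b ℚ.* b′ ℚ.+ (+ N ℚ./ 1) ℚ.* (a ℚ.* a′) ⟩

  _* : ℚ√ N → ℚ√ N
  ⟨ a , b ⟩ * = ⟨ ℚ.- a , b ⟩

  norm : ℚ√ N → ℚ
  norm ⟨ a , b ⟩ = b ℚ.* b ℚ.- (+ N ℚ./ 1) ℚ.* (a ℚ.* a)

  recip : ℚ√ N → ℚ√ N
  recip x@(⟨ a , b ⟩) = ⟨ (ℚ.- a) ℚ.* recipℚ (norm x) , b ℚ.* recipℚ (norm x) ⟩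

  _⊘_ : ℚ√ N → ℚ√ N → ℚ√ N
  x ⊘ y = x ⊗ recip y

-- Integer division made total by i div 0 = 0.  For N not a perfect square, if
-- the root has d > 0 and d ∣ N - c², then so does every vertex, so all the
-- quotients taken below are by positive divisors and are exact.
infixl 7 _div_

_div_ : ℤ → ℤ → ℤ
i div (+ 0)          = + 0
i div j@(+[1+ _ ])   = i ℤ./ j
i div j@(-[1+ _ ])   = i ℤ./ j

record Triple : Set where
  constructor triple
  field
    ε : Sign
    c : ℤ
    d : ℤ

record Vertex (N : ℕ) : Set where
  constructor vertex
  field
    label : ℚ√ N
    tri : Triple
  open Triple tri public

data Step : Set where
  ℓ r : Step

module _ (N : ℕ) where

  leftTriple : Triple → Triple
  leftTriple (triple ε c d) with + 0 ℤ.<? + N ℤ.- (c ℤ.+ d) ℤ.* (c ℤ.+ d)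
  ... | yes _ = triple (opposite ε)
                       ((+ N ℤ.- c ℤ.* c) div d ℤ.- c)
                       ((+ N ℤ.- (c ℤ.+ d) ℤ.* (c ℤ.+ d)) div d)
  ... | no  _ = triple ε
                       (c ℤ.- (+ N ℤ.- c ℤ.* c) div d)
                       (((c ℤ.+ d) ℤ.* (c ℤ.+ d) ℤ.- + N) div d)

  rightTriple : Triple → Triple
  rightTriple (triple ε c d) = triple ε (c ℤ.+ d) d

  child : Step → Vertex N → Vertex N
  child ℓ (vertex x t) = vertex (x ⊘ (x ⊕ fromℤ (+ 1))) (leftTriple t)
  child r (vertex x t) = vertex (x ⊕ fromℤ (+ 1)) (rightTriple t)

  lppStep : Vertex N → Step
  lppStep v with Vertex.ε (child ℓ v)
  ... | Sign.+ = ℓ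
  ... | Sign.- = r

module LPP (N : ℕ) (p q : ℤ) where

  α : ℚ√ N
  α = (√N ⊕ fromℤ p) ⊘ fromℤ q

  lpp : ℕ → Vertex N
  lpp zero    = vertex α (triple Sign.+ p q)
  lpp (suc n) = child N (lppStep N (lpp n)) (lpp n)

  x : ℕ → ℚ√ N
  x n = Vertex.label (lpp n)

  c d : ℕ → ℤ
  c n = Vertex.c (lpp n)
  d n = Vertex.d (lpp n)

  s : ℕ → Step
  s n = lppStep N (lpp n)

  IsLeastPeriod : ℕ → Set
  IsLeastPeriod T =
    0 ℕ.< T × x T ≡ α × (∀ t → 0 ℕ.< t → x t ≡ α → T ℕ.≤ t)

{-# OPTIONS --safe #-}
-- Along the LPP a vertex is determined by (c, d, e) with c² + de = N and d, e > 0.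
-- In these coordinates, with t = d + 2c − e (never 0, as N is not a square), the LPP
-- goes left to (c − e, t, e) if t > 0 and right to (c + d, d, −t) if t < 0, and x ↦ −x*
-- becomes σ : (c, d, e) ↦ (−c, d, e).  Conjugation by σ reverses the LPP: a step from
-- S to S′ is also a step of the same kind from σ S′ to σ S.  So if the m-th vertex is
-- the σ-image of the root, then the (m − j)-th is the σ-image of the j-th.
module Submission where

open import Defs
open import Algebra.Bundles using (module AbelianGroup)
open import Algebra.Properties.Group using (⁻¹-involutive; ∙-cancelˡ)
open import Data.Nat.Base as ℕ using (ℕ; zero; suc; _∸_)
import Data.Nat.DivMod as ℕ
import Data.Nat.Properties as ℕ
open import Data.Integer.Base as ℤ using (ℤ; +_; +[1+_]; 0ℤ)
open import Data.Integer.Divisibility using (_∣_)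
open import Data.Integer.Divisibility.Signed as Signed using (∣ᵤ⇒∣)
import Data.Integer.DivMod as ℤ
import Data.Integer.Properties as ℤ
open import Data.Integer.Tactic.RingSolver using (solve-∀)
open import Data.Product.Base using (_×_; _,_; ∃-syntax)
open import Data.Rational.Base as ℚ using (ℚ; 0ℚ; 1ℚ)
import Data.Rational.Properties as ℚ
open import Data.Rational.Solver using (module +-*-Solver)
import Data.Rational.Unnormalised.Base as ℚᵘ
import Data.Rational.Unnormalised.Properties as ℚᵘ
open import Data.Sign.Base as Sign using (Sign)
open import Data.Sum.Base using (_⊎_; inj₁; inj₂)
open import Function.Base using (_∘_; _$_)
open import Relation.Binary.Definitions using (tri<; tri≈; tri>)
open import Relation.Binary.PropositionalEquality
open import Relation.Nullary.Decidable.Core using (yes; no)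
open import Relation.Nullary.Negation.Core using (¬_; contradiction)

open ≡-Reasoning

-- Exact integer division

-- With both factors positive the product computes as a natural number, which reduces the quotient
-- to division in ℕ.
div-exact : ∀ {i j d} → 0ℤ ℤ.< j → 0ℤ ℤ.< d → i ≡ j ℤ.* d → i div d ≡ j
div-exact {j = +[1+ a ]} {+[1+ b ]} _ _ refl = begin
  (+[1+ a ] ℤ.* +[1+ b ]) ℤ./ +[1+ b ]  ≡⟨ ℤ.div-pos-is-/ℕ (+[1+ a ] ℤ.* +[1+ b ]) (suc b) ⟩
  + (suc a ℕ.* suc b ℕ./ suc b)         ≡⟨ cong +_ (ℕ.m*n/n≡m (suc a) (suc b)) ⟩
  +[1+ a ]                              ∎
div-exact {j = + zero} (ℤ.+<+ ())
div-exact {d = + zero} _ (ℤ.+<+ ())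

*-pos : ∀ {i j} → 0ℤ ℤ.< i → 0ℤ ℤ.< j → 0ℤ ℤ.< i ℤ.* j
*-pos {i} {j} 0<i 0<j =
  subst (ℤ._< i ℤ.* j) (ℤ.*-zeroʳ i) (ℤ.*-monoˡ-<-pos i {{ℤ.positive 0<i}} 0<j)

pos-*-cancelʳ : ∀ {i j} → 0ℤ ℤ.< j → 0ℤ ℤ.< i ℤ.* j → 0ℤ ℤ.< i
pos-*-cancelʳ {i} {j@(+ _)} _ = ℤ.*-cancelʳ-<-nonNeg {0ℤ} {i} j

-- The embedding of ℤ in ℚ, and reciprocals

ι : ℤ → ℚ
ι i = i ℚ./ 1

private
  ιᵘ : ℤ → ℚᵘ.ℚᵘ
  ιᵘ i = ℚᵘ.mkℚᵘ i 0

ι-injective : ∀ {i j} → ι i ≡ ι j → i ≡ j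
ι-injective {i} {j} eq with ℚ.fromℚᵘ-injective {ιᵘ i} {ιᵘ j} eq
... | ℚᵘ.*≡* i*1≡j*1 = trans (sym (ℤ.*-identityʳ i)) (trans i*1≡j*1 (ℤ.*-identityʳ j))

ι-+ : ∀ i j → ι (i ℤ.+ j) ≡ ι i ℚ.+ ι j
ι-+ i j = ℚ.toℚᵘ-injective $
  ℚᵘ.≃-trans (ℚ.toℚᵘ-fromℚᵘ (ιᵘ (i ℤ.+ j))) $
  ℚᵘ.≃-trans (ℚᵘ.*≡* (cross i j)) $ ℚᵘ.≃-sym $
  ℚᵘ.≃-trans (ℚ.toℚᵘ-homo-+ (ι i) (ι j)) $
  ℚᵘ.+-cong (ℚ.toℚᵘ-fromℚᵘ (ιᵘ i)) (ℚ.toℚᵘ-fromℚᵘ (ιᵘ j))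
  where
  cross : ∀ i j → (i ℤ.+ j) ℤ.* + 1 ≡ (i ℤ.* + 1 ℤ.+ j ℤ.* + 1) ℤ.* + 1
  cross = solve-∀

ι-* : ∀ i j → ι (i ℤ.* j) ≡ ι i ℚ.* ι j
ι-* i j = ℚ.toℚᵘ-injective $
  ℚᵘ.≃-trans (ℚ.toℚᵘ-fromℚᵘ (ιᵘ (i ℤ.* j))) $ ℚᵘ.≃-sym $
  ℚᵘ.≃-trans (ℚ.toℚᵘ-homo-* (ι i) (ι j)) $
  ℚᵘ.*-cong (ℚ.toℚᵘ-fromℚᵘ (ιᵘ i)) (ℚ.toℚᵘ-fromℚᵘ (ιᵘ j))

ι-neg : ∀ i → ι (ℤ.- i) ≡ ℚ.- ι i
ι-neg i = ℚ.toℚᵘ-injective $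
  ℚᵘ.≃-trans (ℚ.toℚᵘ-fromℚᵘ (ιᵘ (ℤ.- i))) $ ℚᵘ.≃-sym $
  ℚᵘ.≃-trans (ℚ.toℚᵘ-homo‿- (ι i)) $
  ℚᵘ.-‿cong (ℚ.toℚᵘ-fromℚᵘ (ιᵘ i))

ι-nonzero : ∀ {i} → 0ℤ ℤ.< i → ι i ≢ 0ℚ
ι-nonzero 0<i eq = ℤ.<⇒≢ 0<i (sym (ι-injective eq))

*-recipℚ : ∀ {a} → a ≢ 0ℚ → a ℚ.* recipℚ a ≡ 1ℚ
*-recipℚ {a} a≢0 with a ℚ.≟ 0ℚ
... | yes a≡0 = contradiction a≡0 a≢0
... | no  a≢0 = ℚ.*-inverseʳ a {{ℚ.≢-nonZero a≢0}}

inverse-unique : ∀ {a b c} → a ℚ.* b ≡ 1ℚ → a ℚ.* c ≡ 1ℚ → b ≡ c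
inverse-unique {a} {b} {c} ab≡1 ac≡1 = begin
  b                ≡⟨ ℚ.*-identityʳ b ⟨
  b ℚ.* 1ℚ         ≡⟨ cong (b ℚ.*_) ac≡1 ⟨
  b ℚ.* (a ℚ.* c)  ≡⟨ solve 3 (λ a b c → b :* (a :* c) := (a :* b) :* c) refl a b c ⟩
  (a ℚ.* b) ℚ.* c  ≡⟨ cong (ℚ._* c) ab≡1 ⟩
  1ℚ ℚ.* c         ≡⟨ ℚ.*-identityˡ c ⟩
  c                ∎
  where open +-*-Solver

-- The equation itself forces `a ≢ 0ℚ`, since 0 times `b` is not 1; this rules out the default value
-- of `recipℚ`.
recipℚ-unique : ∀ {a b} → a ℚ.* b ≡ 1ℚ → recipℚ a ≡ b
recipℚ-unique {a} {b} ab≡1 = inverse-unique {a} (*-recipℚ a≢0) ab≡1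
  where
  a≢0 : a ≢ 0ℚ
  a≢0 refl = contradiction (trans (sym (ℚ.*-zeroˡ b)) ab≡1) λ ()

ι-recipℚ : ∀ {i} → 0ℤ ℤ.< i → ι i ℚ.* recipℚ (ι i) ≡ 1ℚ
ι-recipℚ = *-recipℚ ∘ ι-nonzero

-- Serves to recover the denominator d of a label from its surd part 1/d.
recipℚ-ι-injective : ∀ {i j} → 0ℤ ℤ.< i → 0ℤ ℤ.< j → recipℚ (ι i) ≡ recipℚ (ι j) → i ≡ j
recipℚ-ι-injective {i} {j} i>0 j>0 eq = ι-injective $ inverse-unique {recipℚ (ι i)}
  (trans (ℚ.*-comm _ (ι i)) (ι-recipℚ i>0))
  (trans (ℚ.*-comm _ (ι j)) (trans (cong (ι j ℚ.*_) eq) (ι-recipℚ j>0)))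

*-recipℚ-cancel : ∀ {i a b} → 0ℤ ℤ.< i → a ℚ.* recipℚ (ι i) ≡ b ℚ.* recipℚ (ι i) → a ≡ b
*-recipℚ-cancel {i} {a} {b} i>0 eq = trans (sym (cancel a)) (trans (cong (ℚ._* ι i) eq) (cancel b))
  where
  cancel : ∀ y → y ℚ.* recipℚ (ι i) ℚ.* ι i ≡ y
  cancel y = trans (ℚ.*-assoc y _ _) $
    trans (cong (y ℚ.*_) (trans (ℚ.*-comm _ (ι i)) (ι-recipℚ i>0))) (ℚ.*-identityʳ y)

-- Division in ℚ(√N)

module _ {N : ℕ} where

  -- To divide in ℚ(√N) it is enough to exhibit an inverse `z` of the norm, which is then checked by
  -- ring identities.
  recip-norm : ∀ (x : ℚ√ N) {z} → let open ℚ√ x in norm x ℚ.* z ≡ 1ℚ →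
               recip x ≡ ⟨ (ℚ.- surd) ℚ.* z , rational ℚ.* z ⟩
  recip-norm ⟨ a , b ⟩ eq = cong (λ z → ⟨ (ℚ.- a) ℚ.* z , b ℚ.* z ⟩) (recipℚ-unique {norm {N} ⟨ a , b ⟩} eq)

  ⊘-fromℤ : ∀ {a b i} → 0ℤ ℤ.< i →
            ⟨ a , b ⟩ ⊘ fromℤ {N} i ≡ ⟨ a ℚ.* recipℚ (ι i) , b ℚ.* recipℚ (ι i) ⟩
  ⊘-fromℤ {a} {b} {i} 0<i = begin
    ⟨ a , b ⟩ ⊗ recip (fromℤ i)
      ≡⟨ cong (⟨ a , b ⟩ ⊗_) (recip-norm (fromℤ i) norm-inverse) ⟩
    ⟨ a , b ⟩ ⊗ ⟨ (ℚ.- 0ℚ) ℚ.* (u ℚ.* u) , D ℚ.* (u ℚ.* u) ⟩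
      ≡⟨ cong₂ ⟨_,_⟩ surd-part rational-part ⟩
    ⟨ a ℚ.* u , b ℚ.* u ⟩ ∎
    where
    open +-*-Solver
    D u n : ℚ
    D = ι i
    u = recipℚ D
    n = ι (+ N)

    -- The norm of the integer `i` is its square, so the inverse to exhibit is `u ℚ.* u`.
    norm-inverse : (D ℚ.* D ℚ.- n ℚ.* (0ℚ ℚ.* 0ℚ)) ℚ.* (u ℚ.* u) ≡ 1ℚ
    norm-inverse = begin
      (D ℚ.* D ℚ.- n ℚ.* (0ℚ ℚ.* 0ℚ)) ℚ.* (u ℚ.* u)
        ≡⟨ solve 3 (λ D n u → (D :* D :- n :* (con 0ℚ :* con 0ℚ)) :* (u :* u)
                              := (D :* u) :* (D :* u)) refl D n u ⟩
      (D ℚ.* u) ℚ.* (D ℚ.* u)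
        ≡⟨ cong₂ ℚ._*_ (ι-recipℚ 0<i) (ι-recipℚ 0<i) ⟩
      1ℚ ∎

    absorb : ∀ y → y ℚ.* u ℚ.* (D ℚ.* u) ≡ y ℚ.* u
    absorb y = trans (cong (y ℚ.* u ℚ.*_) (ι-recipℚ 0<i)) (ℚ.*-identityʳ _)

    surd-part : a ℚ.* (D ℚ.* (u ℚ.* u)) ℚ.+ b ℚ.* ((ℚ.- 0ℚ) ℚ.* (u ℚ.* u)) ≡ a ℚ.* u
    surd-part = trans
      -- `ℚ.- 0ℚ` computes to `0ℚ`, hence the constant `con 0ℚ`.
      (solve 4 (λ a b D u → a :* (D :* (u :* u)) :+ b :* (con 0ℚ :* (u :* u))
                            := a :* u :* (D :* u)) refl a b D u)
      (absorb a)

    rational-part : b ℚ.* (D ℚ.* (u ℚ.* u)) ℚ.+ n ℚ.* (a ℚ.* ((ℚ.- 0ℚ) ℚ.* (u ℚ.* u)))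
                    ≡ b ℚ.* u
    rational-part = trans
      (solve 5 (λ a b D u n → b :* (D :* (u :* u)) :+ n :* (a :* (con 0ℚ :* (u :* u)))
                              := b :* u :* (D :* u)) refl a b D u n)
      (absorb b)

-- The LPP in the coordinates (c, d, e)

-- Storing the cofactor `e` of `d` in N - c² makes both moves linear: the quotients in `leftTriple`
-- become differences of coordinates.
record State : Set where
  constructor state
  field
    c d e : ℤ

state-≡ : ∀ {c c′ d d′ e e′} → c ≡ c′ → d ≡ d′ → e ≡ e′ → state c d e ≡ state c′ d′ e′
state-≡ refl refl refl = refl

balance : State → ℤ
balance (state c d e) = d ℤ.+ (c ℤ.+ c) ℤ.- e

step : State → Step
step S with 0ℤ ℤ.<? balance S
... | yes _ = ℓ
... | no  _ = r

move : Step → State → State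
move ℓ S@(state c d e) = state (c ℤ.- e) (balance S) e
move r S@(state c d e) = state (c ℤ.+ d) d (ℤ.- balance S)

next : State → State
next S = move (step S) S

σ : State → State
σ (state c d e) = state (ℤ.- c) d e

σ-involutive : ∀ S → σ (σ S) ≡ S
σ-involutive (state c d e) = state-≡ (ℤ.neg-involutive c) refl refl

balance>0⇒ℓ : ∀ {S} → 0ℤ ℤ.< balance S → step S ≡ ℓ
balance>0⇒ℓ {S} 0<t with 0ℤ ℤ.<? balance S
... | yes _   = refl
... | no  0≮t = contradiction 0<t 0≮t

balance<0⇒r : ∀ {S} → balance S ℤ.< 0ℤ → step S ≡ r
balance<0⇒r {S} t<0 with 0ℤ ℤ.<? balance S
... | yes 0<t = contradiction t<0 (ℤ.<-asym 0<t)
... | no  _   = refl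

-- After a left move and σ, subtracting e once more turns e - c into -c, and the balance has become
-- d. After a right move and σ, adding d turns -c - d into -c, and the balance has become -e.
move-reverse : ∀ s S → move s (σ (move s S)) ≡ σ S
move-reverse ℓ (state c d e) = state-≡ (c-eq c e) (d-eq c d e) refl
  where
  c-eq : ∀ c e → ℤ.- (c ℤ.- e) ℤ.- e ≡ ℤ.- c
  c-eq = solve-∀
  d-eq : ∀ c d e → d ℤ.+ (c ℤ.+ c) ℤ.- e ℤ.+ (ℤ.- (c ℤ.- e) ℤ.+ ℤ.- (c ℤ.- e)) ℤ.- e ≡ d
  d-eq = solve-∀
move-reverse r (state c d e) = state-≡ (c-eq c d) refl (e-eq c d e)
  where
  c-eq : ∀ c d → ℤ.- (c ℤ.+ d) ℤ.+ d ≡ ℤ.- c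
  c-eq = solve-∀
  e-eq : ∀ c d e → ℤ.- (d ℤ.+ (ℤ.- (c ℤ.+ d) ℤ.+ ℤ.- (c ℤ.+ d)) ℤ.- (ℤ.- (d ℤ.+ (c ℤ.+ c) ℤ.- e))) ≡ e
  e-eq = solve-∀

-- Orbits and periodicity

orbit : State → ℕ → State
orbit S zero    = S
orbit S (suc n) = next (orbit S n)

module _ (S : State) where

  orbit-shift : ∀ {a b} → orbit S a ≡ orbit S b → ∀ k → orbit S (k ℕ.+ a) ≡ orbit S (k ℕ.+ b)
  orbit-shift eq zero    = eq
  orbit-shift eq (suc k) = cong next (orbit-shift eq k)

  orbit-+* : ∀ T → orbit S T ≡ S → ∀ a k → orbit S (a ℕ.+ k ℕ.* T) ≡ orbit S a
  orbit-+* T periodic a zero    = cong (orbit S) (ℕ.+-identityʳ a)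
  orbit-+* T periodic a (suc k) = begin
    orbit S (a ℕ.+ (T ℕ.+ k ℕ.* T))
      ≡⟨ cong (orbit S) (trans (cong (a ℕ.+_) (ℕ.+-comm T _)) (sym (ℕ.+-assoc a _ T))) ⟩
    orbit S (a ℕ.+ k ℕ.* T ℕ.+ T)
      ≡⟨ orbit-shift periodic (a ℕ.+ k ℕ.* T) ⟩
    orbit S (a ℕ.+ k ℕ.* T ℕ.+ 0)
      ≡⟨ cong (orbit S) (ℕ.+-identityʳ (a ℕ.+ k ℕ.* T)) ⟩
    orbit S (a ℕ.+ k ℕ.* T)
      ≡⟨ orbit-+* T periodic a k ⟩
    orbit S a ∎

  -- Brings any index below the period, which supplies the bound on k(n) in the third claim.
  orbit-% : ∀ T .{{_ : ℕ.NonZero T}} → orbit S T ≡ S → ∀ n → orbit S (n ℕ.% T) ≡ orbit S n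
  orbit-% T periodic n = begin
    orbit S (n ℕ.% T)                      ≡⟨ orbit-+* T periodic (n ℕ.% T) (n ℕ./ T) ⟨
    orbit S (n ℕ.% T ℕ.+ n ℕ./ T ℕ.* T)    ≡⟨ cong (orbit S) (ℕ.m≡m%n+[m/n]*n n T) ⟨
    orbit S n                              ∎

-- Valid states and the numbers they represent

module _ (N : ℕ) where

  record Valid (S : State) : Set where
    constructor valid
    open State S
    field
      equation : + N ≡ c ℤ.* c ℤ.+ d ℤ.* e
      d>0      : 0ℤ ℤ.< d
      e>0      : 0ℤ ℤ.< e

  σ-valid : ∀ {S} → Valid S → Valid (σ S)
  σ-valid {state c d e} (valid eq d>0 e>0) = valid (trans eq (square c d e)) d>0 e>0
    where
    square : ∀ c d e → c ℤ.* c ℤ.+ d ℤ.* e ≡ ℤ.- c ℤ.* ℤ.- c ℤ.+ d ℤ.* e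
    square = solve-∀

  -- This is (√N + c)/d, split into its surd and rational coefficients.
  label : State → ℚ√ N
  label (state c d e) = ⟨ recipℚ (ι d) , ι c ℚ.* recipℚ (ι d) ⟩

  ⟦_⟧ : State → Vertex N
  ⟦ S@(state c d e) ⟧ = vertex (label S) (triple Sign.+ c d)

  -- Conjugation and negation both flip the surd part, which is thus restored; only negation affects
  -- c/d.
  label-σ : ∀ S → ⊝ (label S *) ≡ label (σ S)
  label-σ (state c d e) = cong₂ ⟨_,_⟩ (⁻¹-involutive ℚ.+-0-group _)
    (trans (ℚ.neg-distribˡ-* (ι c) _) (cong (ℚ._* recipℚ (ι d)) (sym (ι-neg c))))

  -- The equation determines d e from N and c, and the positive d cancels.
  valid-unique : ∀ {c c′ d d′ e e′} → Valid (state c d e) → Valid (state c′ d′ e′) →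
                 c ≡ c′ → d ≡ d′ → state c d e ≡ state c′ d′ e′
  valid-unique {c} {d = d} {e = e} {e′} (valid eq d>0 _) (valid eq′ _ _) refl refl =
    state-≡ refl refl $
    ℤ.*-cancelˡ-≡ d e e′ {{ℤ.>-nonZero d>0}} $
    ∙-cancelˡ (AbelianGroup.group ℤ.+-0-abelianGroup) (c ℤ.* c) _ _ (trans (sym eq) eq′)

  -- The surd part 1/d yields d, and then c/d yields c. Equations between numbers, such as x_m =
  -- -α*, thereby become equations between states.
  label-injective : ∀ {S S′} → Valid S → Valid S′ → label S ≡ label S′ → S ≡ S′
  label-injective {state c d e} {state c′ d′ e′} v v′ eq = valid-unique v v′ c≡c′ d≡d′
    where
    d≡d′ : d ≡ d′
    d≡d′ = recipℚ-ι-injective {d} {d′} (Valid.d>0 v) (Valid.d>0 v′) (cong ℚ√.surd eq)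
    c≡c′ : c ≡ c′
    c≡c′ = ι-injective {c} {c′} $ *-recipℚ-cancel {d} {ι c} {ι c′} (Valid.d>0 v) $
      trans (cong ℚ√.rational eq) (cong (λ i → ι c′ ℚ.* recipℚ (ι i)) (sym d≡d′))

  -- The children of a vertex in state coordinates

  -- The left side is the quantity tested by `leftTriple`. As d > 0, the sign of the balance t
  -- decides the branch.
  gap-balance : ∀ {S} → Valid S → let open State S in
                + N ℤ.- (c ℤ.+ d) ℤ.* (c ℤ.+ d) ≡ (ℤ.- balance S) ℤ.* d
  gap-balance {state c d e} (valid eq _ _) =
    trans (cong (λ i → i ℤ.- (c ℤ.+ d) ℤ.* (c ℤ.+ d)) eq) (identity c d e)
    where
    identity : ∀ c d e → c ℤ.* c ℤ.+ d ℤ.* e ℤ.- (c ℤ.+ d) ℤ.* (c ℤ.+ d)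
                         ≡ ℤ.- (d ℤ.+ (c ℤ.+ c) ℤ.- e) ℤ.* d
    identity = solve-∀

  leftTriple-sign : ∀ {S} → Valid S → balance S ℤ.< 0ℤ → let open State S in
                    Triple.ε (leftTriple N (triple Sign.+ c d)) ≡ Sign.-
  leftTriple-sign {state c d e} v t<0 with 0ℤ ℤ.<? + N ℤ.- (c ℤ.+ d) ℤ.* (c ℤ.+ d)
  ... | yes _ = refl
  ... | no  ¬gap>0 = contradiction
    (subst (0ℤ ℤ.<_) (sym (gap-balance v)) (*-pos (ℤ.neg-mono-< t<0) (Valid.d>0 v))) ¬gap>0

  -- For t > 0 the test fails, so the sign stays +. Both quotients are exact because N - c² = e d
  -- and (c + d)² - N = t d.
  leftTriple-ℓ : ∀ {S} → Valid S → 0ℤ ℤ.< balance S → let open State S in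
                 leftTriple N (triple Sign.+ c d) ≡ triple Sign.+ (c ℤ.- e) (balance S)
  leftTriple-ℓ {S@(state c d e)} v@(valid eq d>0 e>0) t>0
    with 0ℤ ℤ.<? + N ℤ.- (c ℤ.+ d) ℤ.* (c ℤ.+ d)
  ... | yes gap>0 = contradiction
    (pos-*-cancelʳ d>0 (subst (0ℤ ℤ.<_) (gap-balance v) gap>0))
    (ℤ.<-asym (ℤ.neg-mono-< t>0))
  ... | no  _ = cong₂ (triple Sign.+)
    (cong (λ i → c ℤ.- i) (div-exact e>0 d>0 e-eq))
    (div-exact t>0 d>0 t-eq)
    where
    e-identity : ∀ c d e → c ℤ.* c ℤ.+ d ℤ.* e ℤ.- c ℤ.* c ≡ e ℤ.* d
    e-identity = solve-∀
    t-identity : ∀ c d e → (c ℤ.+ d) ℤ.* (c ℤ.+ d) ℤ.- (c ℤ.* c ℤ.+ d ℤ.* e)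
                           ≡ (d ℤ.+ (c ℤ.+ c) ℤ.- e) ℤ.* d
    t-identity = solve-∀
    e-eq : + N ℤ.- c ℤ.* c ≡ e ℤ.* d
    e-eq = trans (cong (ℤ._- c ℤ.* c) eq) (e-identity c d e)
    t-eq : (c ℤ.+ d) ℤ.* (c ℤ.+ d) ℤ.- + N ≡ balance S ℤ.* d
    t-eq = trans (cong (λ i → (c ℤ.+ d) ℤ.* (c ℤ.+ d) ℤ.- i) eq) (t-identity c d e)

  lppStep-ℓ : ∀ v → Vertex.ε (child N ℓ v) ≡ Sign.+ → lppStep N v ≡ ℓ
  lppStep-ℓ v eq with Vertex.ε (child N ℓ v) | eq
  ... | _ | refl = refl

  lppStep-r : ∀ v → Vertex.ε (child N ℓ v) ≡ Sign.- → lppStep N v ≡ r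
  lppStep-r v eq with Vertex.ε (child N ℓ v) | eq
  ... | _ | refl = refl

  label-r : ∀ {S} → Valid S → label S ⊕ fromℤ (+ 1) ≡ label (move r S)
  label-r {state c d e} (valid _ d>0 _) = cong₂ ⟨_,_⟩ (ℚ.+-identityʳ _) (begin
    ι c ℚ.* u ℚ.+ 1ℚ          ≡⟨ cong (ι c ℚ.* u ℚ.+_) (ι-recipℚ d>0) ⟨
    ι c ℚ.* u ℚ.+ ι d ℚ.* u   ≡⟨ ℚ.*-distribʳ-+ u (ι c) (ι d) ⟨
    (ι c ℚ.+ ι d) ℚ.* u       ≡⟨ cong (ℚ._* u) (ι-+ c d) ⟨
    ι (c ℤ.+ d) ℚ.* u         ∎)
    where
    u : ℚ
    u = recipℚ (ι d)

  -- The norm of x + 1 is t / d; its inverse is d w with w = 1 / t.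
  label-ℓ : ∀ {S} → Valid S → 0ℤ ℤ.< balance S →
            label S ⊘ (label S ⊕ fromℤ (+ 1)) ≡ label (move ℓ S)
  label-ℓ {S@(state c d e)} v@(valid eq d>0 _) t>0 = begin
    label S ⊘ (label S ⊕ fromℤ (+ 1))
      -- The right move only names x + 1 here: its label involves just c + d and d, whatever the
      -- sign of t.
      ≡⟨ cong (label S ⊘_) (label-r v) ⟩
    label S ⊗ recip (label (move r S))
      ≡⟨ cong (label S ⊗_) (recip-norm (label (move r S)) norm-inverse) ⟩
    label S ⊗ ⟨ (ℚ.- u) ℚ.* (D ℚ.* w) , B ℚ.* u ℚ.* (D ℚ.* w) ⟩
      ≡⟨ cong₂ ⟨_,_⟩ surd-part rational-part ⟩
    ⟨ w , ι (c ℤ.- e) ℚ.* w ⟩ ∎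
    where
    open +-*-Solver
    C D E B n u w : ℚ
    C = ι c
    D = ι d
    E = ι e
    B = ι (c ℤ.+ d)
    n = ι (+ N)
    u = recipℚ D
    w = recipℚ (ι (balance S))

    Du≡1 : D ℚ.* u ≡ 1ℚ
    Du≡1 = ι-recipℚ d>0

    n-eq : n ≡ C ℚ.* C ℚ.+ D ℚ.* E
    n-eq = trans (cong ι eq) (trans (ι-+ (c ℤ.* c) (d ℤ.* e)) (cong₂ ℚ._+_ (ι-* c c) (ι-* d e)))

    B-eq : B ≡ C ℚ.+ D
    B-eq = ι-+ c d

    ι-minus : ∀ i j → ι (i ℤ.- j) ≡ ι i ℚ.- ι j
    ι-minus i j = trans (ι-+ i (ℤ.- j)) (cong (ι i ℚ.+_) (ι-neg j))

    t-eq : ι (balance S) ≡ D ℚ.+ (C ℚ.+ C) ℚ.- E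
    t-eq = trans (ι-minus (d ℤ.+ (c ℤ.+ c)) e) $ cong (ℚ._- E) $
      trans (ι-+ d (c ℤ.+ c)) (cong (D ℚ.+_) (ι-+ c c))

    norm-inverse : (B ℚ.* u ℚ.* (B ℚ.* u) ℚ.- n ℚ.* (u ℚ.* u)) ℚ.* (D ℚ.* w) ≡ 1ℚ
    norm-inverse = begin
      (B ℚ.* u ℚ.* (B ℚ.* u) ℚ.- n ℚ.* (u ℚ.* u)) ℚ.* (D ℚ.* w)
        ≡⟨ cong₂ (λ B n → (B ℚ.* u ℚ.* (B ℚ.* u) ℚ.- n ℚ.* (u ℚ.* u)) ℚ.* (D ℚ.* w)) B-eq n-eq ⟩
      ((C ℚ.+ D) ℚ.* u ℚ.* ((C ℚ.+ D) ℚ.* u) ℚ.- (C ℚ.* C ℚ.+ D ℚ.* E) ℚ.* (u ℚ.* u)) ℚ.* (D ℚ.* w)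
        -- All occurrences of u are gathered into (D u)², which is 1.
        ≡⟨ solve 5 (λ C D E u w →
             ((C :+ D) :* u :* ((C :+ D) :* u) :- (C :* C :+ D :* E) :* (u :* u)) :* (D :* w)
             := (D :* u) :* (D :* u) :* ((D :+ (C :+ C) :- E) :* w)) refl C D E u w ⟩
      (D ℚ.* u) ℚ.* (D ℚ.* u) ℚ.* ((D ℚ.+ (C ℚ.+ C) ℚ.- E) ℚ.* w)
        ≡⟨ cong₂ ℚ._*_ (cong₂ ℚ._*_ Du≡1 Du≡1) (cong (ℚ._* w) (sym t-eq)) ⟩
      1ℚ ℚ.* (ι (balance S) ℚ.* w)
        ≡⟨ trans (ℚ.*-identityˡ _) (ι-recipℚ t>0) ⟩
      1ℚ ∎

    surd-part : u ℚ.* (B ℚ.* u ℚ.* (D ℚ.* w)) ℚ.+ C ℚ.* u ℚ.* ((ℚ.- u) ℚ.* (D ℚ.* w)) ≡ w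
    surd-part = begin
      u ℚ.* (B ℚ.* u ℚ.* (D ℚ.* w)) ℚ.+ C ℚ.* u ℚ.* ((ℚ.- u) ℚ.* (D ℚ.* w))
        ≡⟨ cong (λ B → u ℚ.* (B ℚ.* u ℚ.* (D ℚ.* w)) ℚ.+ C ℚ.* u ℚ.* ((ℚ.- u) ℚ.* (D ℚ.* w))) B-eq ⟩
      u ℚ.* ((C ℚ.+ D) ℚ.* u ℚ.* (D ℚ.* w)) ℚ.+ C ℚ.* u ℚ.* ((ℚ.- u) ℚ.* (D ℚ.* w))
        ≡⟨ solve 4 (λ C D u w →
             u :* ((C :+ D) :* u :* (D :* w)) :+ C :* u :* ((:- u) :* (D :* w))
             := (D :* u) :* (D :* u) :* w) refl C D u w ⟩
      (D ℚ.* u) ℚ.* (D ℚ.* u) ℚ.* w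
        ≡⟨ cong (ℚ._* w) (cong₂ ℚ._*_ Du≡1 Du≡1) ⟩
      1ℚ ℚ.* w
        ≡⟨ ℚ.*-identityˡ w ⟩
      w ∎

    rational-part : C ℚ.* u ℚ.* (B ℚ.* u ℚ.* (D ℚ.* w)) ℚ.+ n ℚ.* (u ℚ.* ((ℚ.- u) ℚ.* (D ℚ.* w)))
                    ≡ ι (c ℤ.- e) ℚ.* w
    rational-part = begin
      C ℚ.* u ℚ.* (B ℚ.* u ℚ.* (D ℚ.* w)) ℚ.+ n ℚ.* (u ℚ.* ((ℚ.- u) ℚ.* (D ℚ.* w)))
        ≡⟨ cong₂ (λ B n → C ℚ.* u ℚ.* (B ℚ.* u ℚ.* (D ℚ.* w))
                          ℚ.+ n ℚ.* (u ℚ.* ((ℚ.- u) ℚ.* (D ℚ.* w)))) B-eq n-eq ⟩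
      C ℚ.* u ℚ.* ((C ℚ.+ D) ℚ.* u ℚ.* (D ℚ.* w))
        ℚ.+ (C ℚ.* C ℚ.+ D ℚ.* E) ℚ.* (u ℚ.* ((ℚ.- u) ℚ.* (D ℚ.* w)))
        ≡⟨ solve 5 (λ C D E u w →
             C :* u :* ((C :+ D) :* u :* (D :* w))
               :+ (C :* C :+ D :* E) :* (u :* ((:- u) :* (D :* w)))
             := (D :* u) :* (D :* u) :* ((C :- E) :* w)) refl C D E u w ⟩
      (D ℚ.* u) ℚ.* (D ℚ.* u) ℚ.* ((C ℚ.- E) ℚ.* w)
        ≡⟨ cong₂ ℚ._*_ (cong₂ ℚ._*_ Du≡1 Du≡1) (cong (ℚ._* w) (sym (ι-minus c e))) ⟩
      1ℚ ℚ.* (ι (c ℤ.- e) ℚ.* w)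
        ≡⟨ ℚ.*-identityˡ _ ⟩
      ι (c ℤ.- e) ℚ.* w ∎

  -- Dynamics on valid states for nonsquare N

  module _ (nonsquare : ¬ PerfectSquare N) where

    nonsquareℤ : ∀ i → + N ≢ i ℤ.* i
    nonsquareℤ i eq = nonsquare (ℤ.∣ i ∣ , trans (cong ℤ.∣_∣ eq) (ℤ.abs-* i i))

    -- By `gap-balance`, t = 0 would give N = (c + d)²; this is where nonsquareness enters.
    balance-nonzero : ∀ {S} → Valid S → balance S ≢ 0ℤ
    balance-nonzero {state c d e} v t≡0 =
      nonsquareℤ (c ℤ.+ d) $ ℤ.i-j≡0⇒i≡j _ _ $
      trans (gap-balance v) (cong (λ t → (ℤ.- t) ℤ.* d) t≡0)

    balance-sign : ∀ {S} → Valid S → 0ℤ ℤ.< balance S ⊎ balance S ℤ.< 0ℤ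
    balance-sign {S} v with ℤ.<-cmp 0ℤ (balance S)
    ... | tri< 0<t _ _ = inj₁ 0<t
    ... | tri≈ _ 0≡t _ = contradiction (sym 0≡t) (balance-nonzero v)
    ... | tri> _ _ t<0 = inj₂ t<0

    -- The balance of `σ (next S)` is d > 0 after a left step and -e < 0 after a right step.
    step-reverse : ∀ {S} → Valid S → step (σ (next S)) ≡ step S
    step-reverse {S@(state c d e)} v@(valid _ d>0 e>0) with balance-sign v
    ... | inj₁ t>0 rewrite balance>0⇒ℓ {S} t>0 =
      balance>0⇒ℓ (subst (0ℤ ℤ.<_) (sym (identity c d e)) d>0)
      where
      identity : ∀ c d e → d ℤ.+ (c ℤ.+ c) ℤ.- e ℤ.+ (ℤ.- (c ℤ.- e) ℤ.+ ℤ.- (c ℤ.- e)) ℤ.- e ≡ d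
      identity = solve-∀
    ... | inj₂ t<0 rewrite balance<0⇒r {S} t<0 =
      balance<0⇒r (subst (ℤ._< 0ℤ) (sym (identity c d e)) (ℤ.neg-mono-< e>0))
      where
      identity : ∀ c d e → d ℤ.+ (ℤ.- (c ℤ.+ d) ℤ.+ ℤ.- (c ℤ.+ d)) ℤ.- (ℤ.- (d ℤ.+ (c ℤ.+ c) ℤ.- e))
                           ≡ ℤ.- e
      identity = solve-∀

    next-reverse : ∀ {S} → Valid S → next (σ (next S)) ≡ σ S
    next-reverse {S} v =
      trans (cong (λ s → move s (σ (next S))) (step-reverse v)) (move-reverse (step S) S)

    -- The equation is preserved identically, and the choice of step makes the new coordinate, t or
    -- -t, positive.
    next-valid : ∀ {S} → Valid S → Valid (next S)
    next-valid {S@(state c d e)} v@(valid eq d>0 e>0) with balance-sign v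
    ... | inj₁ t>0 rewrite balance>0⇒ℓ {S} t>0 =
      valid (trans eq (identity c d e)) t>0 e>0
      where
      identity : ∀ c d e → c ℤ.* c ℤ.+ d ℤ.* e
                           ≡ (c ℤ.- e) ℤ.* (c ℤ.- e) ℤ.+ (d ℤ.+ (c ℤ.+ c) ℤ.- e) ℤ.* e
      identity = solve-∀
    ... | inj₂ t<0 rewrite balance<0⇒r {S} t<0 =
      valid (trans eq (identity c d e)) d>0 (ℤ.neg-mono-< t<0)
      where
      identity : ∀ c d e → c ℤ.* c ℤ.+ d ℤ.* e
                           ≡ (c ℤ.+ d) ℤ.* (c ℤ.+ d) ℤ.+ d ℤ.* (ℤ.- (d ℤ.+ (c ℤ.+ c) ℤ.- e))
      identity = solve-∀

    -- The left child keeps the sign + when t > 0 and flips it when t < 0, so the LPP rule reads off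
    -- the sign of t.
    lppStep-⟦⟧ : ∀ {S} → Valid S → lppStep N ⟦ S ⟧ ≡ step S
    lppStep-⟦⟧ {S} v with balance-sign v
    ... | inj₁ t>0 = trans (lppStep-ℓ ⟦ S ⟧ (cong Triple.ε (leftTriple-ℓ v t>0))) (sym (balance>0⇒ℓ {S} t>0))
    ... | inj₂ t<0 = trans (lppStep-r ⟦ S ⟧ (leftTriple-sign v t<0)) (sym (balance<0⇒r {S} t<0))

    child-step : ∀ {S} → Valid S → child N (step S) ⟦ S ⟧ ≡ ⟦ next S ⟧
    child-step {S} v with balance-sign v
    ... | inj₁ t>0 = subst (λ s → child N s ⟦ S ⟧ ≡ ⟦ move s S ⟧) (sym (balance>0⇒ℓ {S} t>0))
                           (cong₂ vertex (label-ℓ v t>0) (leftTriple-ℓ v t>0))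
    ... | inj₂ t<0 = subst (λ s → child N s ⟦ S ⟧ ≡ ⟦ move s S ⟧) (sym (balance<0⇒r {S} t<0))
                           (cong₂ vertex (label-r v) refl)

    child-lppStep : ∀ {S} → Valid S → child N (lppStep N ⟦ S ⟧) ⟦ S ⟧ ≡ ⟦ next S ⟧
    child-lppStep {S} v = trans (cong (λ s → child N s ⟦ S ⟧) (lppStep-⟦⟧ v)) (child-step v)

    -- Reversal of orbits under σ

    orbit-valid : ∀ {S} → Valid S → ∀ n → Valid (orbit S n)
    orbit-valid v zero    = v
    orbit-valid v (suc n) = next-valid (orbit-valid v n)

    -- Induction on j. By `next-reverse`, the state at m - (j + 1) is obtained from its successor at
    -- m - j by σ, `next`, σ; the induction hypothesis rewrites that successor as the σ-image of the
    -- j-th state.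
    orbit-reverse : ∀ {S} → Valid S → ∀ {m} → orbit S m ≡ σ S →
                    ∀ j → j ℕ.≤ m → orbit S (m ∸ j) ≡ σ (orbit S j)
    orbit-reverse v m-eq zero    _   = m-eq
    orbit-reverse {S} v {m} m-eq (suc j) j<m = begin
      orbit S (m ∸ suc j)
        ≡⟨ σ-involutive (orbit S (m ∸ suc j)) ⟨
      σ (σ (orbit S (m ∸ suc j)))
        ≡⟨ cong σ (next-reverse (orbit-valid v (m ∸ suc j))) ⟨
      σ (next (σ (orbit S (suc (m ∸ suc j)))))
        -- `j<m` keeps the subtraction from truncating, so the successor of m - (j + 1) is m - j.
        ≡⟨ cong (λ i → σ (next (σ (orbit S i)))) (ℕ.+-∸-assoc 1 j<m) ⟨
      σ (next (σ (orbit S (m ∸ j))))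
        ≡⟨ cong (σ ∘ next ∘ σ) (orbit-reverse v m-eq j (ℕ.<⇒≤ j<m)) ⟩
      σ (next (σ (σ (orbit S j))))
        ≡⟨ cong (σ ∘ next) (σ-involutive (orbit S j)) ⟩
      σ (orbit S (suc j)) ∎

    -- The step out of index m - 1 - j equals the step out of the σ-image of its successor at m - j,
    -- and that image is the j-th state.
    step-palindrome : ∀ {S} → Valid S → ∀ {m} → orbit S m ≡ σ S →
                      ∀ j → j ℕ.< m → step (orbit S (m ∸ 1 ∸ j)) ≡ step (orbit S j)
    step-palindrome {S} v {suc m} m-eq j (ℕ.s≤s j≤m) = begin
      step (orbit S (m ∸ j))
        ≡⟨ step-reverse (orbit-valid v (m ∸ j)) ⟨
      step (σ (orbit S (suc (m ∸ j))))
        ≡⟨ cong (step ∘ σ ∘ orbit S) (ℕ.+-∸-assoc 1 j≤m) ⟨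
      step (σ (orbit S (suc m ∸ j)))
        ≡⟨ cong (step ∘ σ) (orbit-reverse v m-eq j (ℕ.m≤n⇒m≤1+n j≤m)) ⟩
      step (σ (σ (orbit S j)))
        ≡⟨ cong step (σ-involutive (orbit S j)) ⟩
      step (orbit S j) ∎

    -- Reversal needs n at most the turning index, which m may violate. Periodicity lets m + T
    -- replace m, and n ≤ T ≤ m + T; the index m + T - n is then reduced modulo T.
    orbit-σ-closed : ∀ {S} → Valid S → ∀ {m T} → orbit S m ≡ σ S → 0 ℕ.< T → orbit S T ≡ S →
                     ∀ n → n ℕ.≤ T → ∃[ k ] (k ℕ.≤ T × σ (orbit S n) ≡ orbit S k)
    orbit-σ-closed {S} v {m} {T@(suc _)} m-eq _ periodic n n≤T =
      i ℕ.% T , ℕ.<⇒≤ (ℕ.m%n<n i T) , (begin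
        σ (orbit S n)      ≡⟨ orbit-reverse v m+T-eq n (ℕ.≤-trans n≤T (ℕ.m≤n+m T m)) ⟨
        orbit S i          ≡⟨ orbit-% S T periodic i ⟨
        orbit S (i ℕ.% T)  ∎)
      where
      i : ℕ
      i = m ℕ.+ T ∸ n
      m+T-eq : orbit S (m ℕ.+ T) ≡ σ S
      m+T-eq = trans (orbit-shift S periodic m) (trans (cong (orbit S) (ℕ.+-identityʳ m)) m-eq)

-- The midpoint and the root

-- For nonzero i the two sides have different constructors, so only the zero clause remains.
i≡-i⇒i≡0 : ∀ i → i ≡ ℤ.- i → i ≡ 0ℤ
i≡-i⇒i≡0 (+ zero) _ = refl

label-c≡0 : ∀ {N c d e} → c ≡ 0ℤ → 0ℤ ℤ.< d → label N (state c d e) ≡ √N ⊘ fromℤ d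
label-c≡0 {N} {d = d} {e} refl d>0 = begin
  ⟨ u , 0ℚ ℚ.* u ⟩        ≡⟨ cong ⟨_, 0ℚ ℚ.* u ⟩ (ℚ.*-identityˡ u) ⟨
  ⟨ 1ℚ ℚ.* u , 0ℚ ℚ.* u ⟩ ≡⟨ ⊘-fromℤ {N} {1ℚ} {0ℚ} d>0 ⟨
  √N ⊘ fromℤ d            ∎
  where
  u : ℚ
  u = recipℚ (ι d)

-- The divisibility witness is e = (N - p²)/q, positive because p² < N and q > 0.
root-state : ∀ {N p q} → p ℤ.* p ℤ.< + N → 0ℤ ℤ.< q → q ∣ (+ N ℤ.- p ℤ.* p) →
             ∃[ e ] Valid N (state p q e)
root-state {N} {p} {q} p²<N q>0 q∣ with ∣ᵤ⇒∣ q∣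
... | Signed.divides e eq = e , valid N-eq q>0 (pos-*-cancelʳ q>0 (subst (0ℤ ℤ.<_) eq gap>0))
  where
  gap>0 : 0ℤ ℤ.< + N ℤ.- p ℤ.* p
  gap>0 = subst (ℤ._< + N ℤ.- p ℤ.* p) (ℤ.+-inverseʳ (p ℤ.* p)) (ℤ.+-monoˡ-< (ℤ.- (p ℤ.* p)) p²<N)
  split : ∀ n s → n ≡ s ℤ.+ (n ℤ.- s)
  split = solve-∀
  N-eq : + N ≡ p ℤ.* p ℤ.+ q ℤ.* e
  N-eq = trans (split (+ N) (p ℤ.* p)) (cong (λ i → p ℤ.* p ℤ.+ i) (trans eq (ℤ.*-comm e q)))

-- Transfer from state orbits to the LPP

module _ {N p q e} (nonsquare : ¬ PerfectSquare N) (v : Valid N (state p q e)) where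

  open LPP N p q

  private
    S : ℕ → State
    S = orbit (state p q e)

    S-valid : ∀ n → Valid N (S n)
    S-valid = orbit-valid N nonsquare v

  α≡label : α ≡ label N (state p q e)
  α≡label = trans (⊘-fromℤ {N} {1ℚ ℚ.+ 0ℚ} {0ℚ ℚ.+ ι p} (Valid.d>0 v)) $
    cong₂ ⟨_,_⟩ (ℚ.*-identityˡ u) (cong (ℚ._* u) (ℚ.+-identityˡ (ι p)))
    where
    u : ℚ
    u = recipℚ (ι q)

  -- Whole vertices are compared, so the statements about x, c, d and s all follow from this one; it
  -- also contains ε = 1 along the LPP.
  lpp≡orbit : ∀ n → lpp n ≡ ⟦_⟧ N (S n)
  lpp≡orbit zero    = cong (λ y → vertex y (triple Sign.+ p q)) α≡label
  lpp≡orbit (suc n) = trans (cong (λ w → child N (lppStep N w) w) (lpp≡orbit n))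
                            (child-lppStep N nonsquare (S-valid n))

  x≡label : ∀ n → x n ≡ label N (S n)
  x≡label n = cong Vertex.label (lpp≡orbit n)

  c≡orbit : ∀ n → c n ≡ State.c (S n)
  c≡orbit n = cong Vertex.c (lpp≡orbit n)

  d≡orbit : ∀ n → d n ≡ State.d (S n)
  d≡orbit n = cong Vertex.d (lpp≡orbit n)

  s≡step : ∀ n → s n ≡ step (S n)
  s≡step n = trans (cong (lppStep N) (lpp≡orbit n)) (lppStep-⟦⟧ N nonsquare (S-valid n))

  ⊝x*≡label-σ : ∀ n → ⊝ (x n *) ≡ label N (σ (S n))
  ⊝x*≡label-σ n = trans (cong (λ y → ⊝ (y *)) (x≡label n)) (label-σ N (S n))

  orbit-conjugate : ∀ {m} → x m ≡ ⊝ (α *) → S m ≡ σ (S 0)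
  orbit-conjugate {m} eq = label-injective N (S-valid m) (σ-valid N v)
    (trans (sym (x≡label m)) (trans eq (⊝x*≡label-σ 0)))

  orbit-period : ∀ {T} → x T ≡ α → S T ≡ S 0
  orbit-period {T} eq = label-injective N (S-valid T) v
    (trans (sym (x≡label T)) (trans eq α≡label))

  module _ {m} (S-m : S m ≡ σ (S 0)) where

    reverse : ∀ j → j ℕ.≤ m → S (m ∸ j) ≡ σ (S j)
    reverse = orbit-reverse N nonsquare v {m} S-m

    c-antisymmetric : ∀ j → j ℕ.≤ m → c (m ∸ j) ≡ ℤ.- c j
    c-antisymmetric j j≤m = begin
      c (m ∸ j)              ≡⟨ c≡orbit (m ∸ j) ⟩
      State.c (S (m ∸ j))    ≡⟨ cong State.c (reverse j j≤m) ⟩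
      ℤ.- State.c (S j)      ≡⟨ cong ℤ.-_ (c≡orbit j) ⟨
      ℤ.- c j                ∎

    d-symmetric : ∀ j → j ℕ.≤ m → d (m ∸ j) ≡ d j
    d-symmetric j j≤m = begin
      d (m ∸ j)              ≡⟨ d≡orbit (m ∸ j) ⟩
      State.d (S (m ∸ j))    ≡⟨ cong State.d (reverse j j≤m) ⟩
      State.d (S j)          ≡⟨ d≡orbit j ⟨
      d j                    ∎

    -- At j = k the index m - k is k again, so antisymmetry makes c_k its own negative.
    midpoint-c : ∀ k → m ≡ 2 ℕ.* k → c k ≡ + 0
    midpoint-c k refl = i≡-i⇒i≡0 (c k) $
      -- `2 ℕ.* k` unfolds to `k ℕ.+ (k ℕ.+ 0)`, so subtracting k leaves `k ℕ.+ 0`.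
      trans (cong c (sym (trans (ℕ.m+n∸m≡n k (k ℕ.+ 0)) (ℕ.+-identityʳ k))))
            (c-antisymmetric k (ℕ.m≤m+n k _))

    midpoint-x : ∀ k → m ≡ 2 ℕ.* k → x k ≡ √N ⊘ fromℤ (d k)
    midpoint-x k m≡2k = begin
      x k                         ≡⟨ x≡label k ⟩
      label N (S k)               ≡⟨ label-c≡0 {e = State.e (S k)} c≡0 (Valid.d>0 (S-valid k)) ⟩
      √N ⊘ fromℤ (State.d (S k))  ≡⟨ cong (λ i → √N ⊘ fromℤ i) (d≡orbit k) ⟨
      √N ⊘ fromℤ (d k)            ∎
      where
      c≡0 : State.c (S k) ≡ 0ℤ
      c≡0 = trans (sym (c≡orbit k)) (midpoint-c k m≡2k)

    s-palindrome : ∀ j → j ℕ.< m → s (m ∸ 1 ∸ j) ≡ s j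
    s-palindrome j j<m = trans (s≡step (m ∸ 1 ∸ j)) $
      trans (step-palindrome N nonsquare v {m} S-m j j<m) (sym (s≡step j))

    conjugate-closed : ∀ T → IsLeastPeriod T → ∀ n → n ℕ.≤ T → ∃[ k ] (k ℕ.≤ T × ⊝ (x n *) ≡ x k)
    conjugate-closed T (T>0 , x-T , _) n n≤T =
      let k , k≤T , eq = orbit-σ-closed N nonsquare v {m} {T} S-m T>0 (orbit-period {T} x-T) n n≤T
      in k , k≤T , trans (⊝x*≡label-σ n) (trans (cong (label N) eq) (sym (x≡label k)))

corollary2 : (N : ℕ) (p q : ℤ) →
    0 ℕ.< N → ¬ PerfectSquare N →
    p ℤ.* p ℤ.< + N →
    + 0 ℤ.< q → q ∣ (+ N ℤ.- p ℤ.* p) →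
    let open LPP N p q in
    (m : ℕ) → 0 ℕ.< m → x m ≡ ⊝ (α *) →
    ( (∀ j → j ℕ.≤ m → c (m ∸ j) ≡ ℤ.- c j)
    × (∀ j → j ℕ.≤ m → d (m ∸ j) ≡ d j)
    × (∀ k → m ≡ 2 ℕ.* k → c k ≡ + 0 × x k ≡ √N ⊘ fromℤ (d k)) )
    × (∀ j → j ℕ.< m → s (m ∸ 1 ∸ j) ≡ s j)
    × (∀ T → IsLeastPeriod T → ∀ n → n ℕ.≤ T → ∃[ k ] (k ℕ.≤ T × ⊝ (x n *) ≡ x k))
corollary2 N p q _ nonsquare p²<N q>0 q∣ m _ x-m =
  let e , v = root-state p²<N q>0 q∣
      S-m   = orbit-conjugate nonsquare v {m} x-m
  in ( c-antisymmetric nonsquare v {m} S-m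
     , d-symmetric nonsquare v {m} S-m
     , λ k m≡2k → midpoint-c nonsquare v {m} S-m k m≡2k , midpoint-x nonsquare v {m} S-m k m≡2k )
   , s-palindrome nonsquare v {m} S-m
   , conjugate-closed nonsquare v {m} S-m
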